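{- Let $f:2^V\to\mathbb{Z}_{\ge0}$ be a connectivity function, $T$ a branch decomposition of $f$, $r\in E(T)$, and $(r,C_1,C_2,C_3)$ a global $T$-improvement. Then for every $i\in\{1,2,3\}$ and every node $w\in V(T)$ it holds that $f(T_r[w]\cap C_i)\le f(T_r[w])$. Moreover, if $T_r[w]\cap C_i\neq\emptyset$, then $f(T_r[w]\cap C_i)=f(T_r[w])$ if and only if $T_r[w]\subseteq C_i$.
   Context: A connectivity function $f:2^V\to\mathbb{Z}_{\ge0}$ ($V$ finite) satisfies $f(\emptyset)=0$, $f(X)=f(V\setminus X)$, and $f(X\cup Y)+f(X\cap Y)\le f(X)+f(Y)$. A branch decomposition of $f$ is a tree $T$ whose nodes have degree 1 or 3 together with a bijection from $V$ to its leaves; elements of $V$ are identified with leaves. For an edge $uv$ of $T$, $T[uv]$ denotes the set of leaves closer to $u$ than to $v$. For an edge $r=uv$ and a node $w$, the $r$-subtree of $w$ consists of the nodes $x$ such that $w$ lies on the unique path from $x$ to the edge $r$ (including $w$), and $T_r[w]\subseteq V$ is the set of leaves in the $r$-subtree of $w$ (so $T_r[u]=T[uv]$, $T_r[v]=T[vu]$). For $W\subseteq V$, a $W$-improvement is a tripartition $(C_1,C_2,C_3)$ of $V$ (pairwise disjoint, possibly empty, union $V$) with $f(C_i)<f(W)/2$, $f(C_i\cap W)<f(W)$, $f(C_i\cap(V\setminus W))<f(W)$ for each $i$. Its width is $\max_i f(C_i)$, its sum-width is $\sum_i f(C_i)$, and its arity is the number of nonempty $C_i$. A $W$-improvement is minimum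 if it has minimum width among all $W$-improvements, subject to that minimum arity, and subject to those minimum sum-width. For $r=uv\in E(T)$ and $W=T[uv]$, a $T$-improvement on $r$ is a tuple $(r,C_1,C_2,C_3)$ where $(C_1,C_2,C_3)$ is a minimum $W$-improvement; it intersects a node $w$ if $T_r[w]$ intersects at least two of $C_1,C_2,C_3$. A global $T$-improvement is a $T$-improvement on $r$ that intersects the minimum number of nodes of $T$ among all $T$-improvements on $r$. -}

module Defs where

open import Data.Fin.Base using (Fin)
open import Data.Fin.Patterns using (0F; 1F; 2F)
open import Data.Fin.Properties using (_≟_)
open import Data.Fin.Subset
  using (Subset; _∩_; _∪_; ∁; ⊤; ⊥; ∣_∣; Nonempty; Empty)
open import Data.Fin.Subset.Properties using (nonempty?)
open import Data.List.Base using (List; []; _∷_)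
import Data.List.Membership.Propositional as List
import Data.List.Membership.DecPropositional as DecMembership
open import Data.List.Relation.Unary.Unique.Propositional using (Unique)
open import Data.Nat.Base using (ℕ; suc; _+_; _*_; _≤_; _<_; _⊔_)
open import Data.Nat.Properties using (_≤?_; _<?_)
open import Data.Product.Base using (Σ-syntax; proj₁)
open import Data.Sum.Base using (_⊎_)
open import Data.Bool.Base using (if_then_else_)
open import Data.Vec.Base using (tabulate)
open import Function.Base using (_∘_)
open import Function.Bundles using (_⤖_; module Bijection)
open import Level using (Level; 0ℓ)
open import Relation.Binary.Construct.Closure.ReflexiveTransitive
  using (Star; ε; _◅_)
open import Relation.Binary.Core using (Rel)
import Relation.Binary.Definitions as B
open import Relation.Binary.PropositionalEquality.Core using (_≡_; _≢_)
open import Relation.Nullary.Decidable.Core using (does)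
open import Relation.Nullary.Negation.Core using (¬_)
open import Relation.Unary using (Pred; Decidable)

private
  variable
    ℓ : Level
    k n : ℕ

⟪_⟫ : {P : Pred (Fin k) ℓ} → Decidable P → Subset k
⟪ P? ⟫ = tabulate (does ∘ P?)

record IsConnectivityFunction (f : Subset n → ℕ) : Set where
  field
    f-⊥         : f ⊥ ≡ 0
    symmetric   : ∀ X → f X ≡ f (∁ X)
    submodular  : ∀ X Y → f (X ∪ Y) + f (X ∩ Y) ≤ f X + f Y

------------------------------------------------------------------------
-- Finite simple graphs and trees

record Graph : Set₁ where
  infix 4 _~_ _~?_
  field
    order   : ℕ
  Node : Set
  Node = Fin order
  field
    _~_     : Rel Node 0ℓ
    _~?_    : B.Decidable _~_
    ~-sym   : B.Symmetric _~_
    ~-irrefl : B.Irreflexive _≡_ _~_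

  degree : Node → ℕ
  degree x = ∣ ⟪ x ~?_ ⟫ ∣

  Walk : Rel Node 0ℓ
  Walk = Star _~_

  vertices : ∀ {x y} → Walk x y → List Node
  vertices {x} ε       = x ∷ []
  vertices {x} (_ ◅ p) = x ∷ vertices p

  length : ∀ {x y} → Walk x y → ℕ
  length ε       = 0
  length (_ ◅ p) = suc (length p)

  Path : Rel Node 0ℓ
  Path x y = Σ[ p ∈ Walk x y ] Unique (vertices p)

  record Edge : Set where
    constructor edge
    field
      u v : Node
      u~v : u ~ v

record IsTree (G : Graph) : Set where
  open Graph G
  field
    connected : ∀ x y → Path x y
    -- A cycle is a path of length at least two whose ends are adjacent.
    acyclic   : ∀ {x y} (p : Path x y) → 2 ≤ length (proj₁ p) → ¬ (y ~ x)

-- The branch decompositions of any set function on subsets of Fin n; the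
-- function itself plays no role in the definition.
record BranchDecomposition (n : ℕ) : Set₁ where
  field
    graph  : Graph
    isTree : IsTree graph
  open Graph graph public
  open IsTree isTree public
  field
    degree-1-or-3 : ∀ x → degree x ≡ 1 ⊎ degree x ≡ 3
    leaves        : Fin n ⤖ (Σ[ x ∈ Node ] degree x ≡ 1)

  open DecMembership (_≟_ {order}) using (_∈?_)

  leaf : Fin n → Node
  leaf = proj₁ ∘ Bijection.to leaves

  -- In a tree the path between two nodes is unique, so the one provided by
  -- connectedness is the path from x to y and its length is their distance.
  path : ∀ x y → Walk x y
  path x y = proj₁ (connected x y)

  dist : Node → Node → ℕ
  dist x y = length (path x y)

  T[_,_] : Node → Node → Subset n
  T[ u , v ] = ⟪ (λ a → dist (leaf a) u <? dist (leaf a) v) ⟫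

  -- The path from x to the edge r stops at the end of r that is closer to x;
  -- in a tree the two ends of an edge are never equidistant from x.
  pathToEdge : Edge → Node → List Node
  pathToEdge (edge u v _) x =
    if does (dist x u <? dist x v)
    then vertices (path x u)
    else vertices (path x v)

  InSubtree : Edge → Node → Pred Node 0ℓ
  InSubtree r w x = w List.∈ pathToEdge r x

  inSubtree? : ∀ r w → Decidable (InSubtree r w)
  inSubtree? r w x = w ∈? pathToEdge r x

  T⟨_⟩[_] : Edge → Node → Subset n
  T⟨ r ⟩[ w ] = ⟪ inSubtree? r w ∘ leaf ⟫

------------------------------------------------------------------------
-- Improvements

Triple : ℕ → Set
Triple n = Fin 3 → Subset n

record IsTripartition (C : Triple n) : Set where
  field
    disjoint : ∀ i j → i ≢ j → Empty (C i ∩ C j)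
    union    : C 0F ∪ C 1F ∪ C 2F ≡ ⊤

arity : Triple n → ℕ
arity C = ∣ ⟪ (λ i → nonempty? (C i)) ⟫ ∣

module _ (f : Subset n → ℕ) where

  width : Triple n → ℕ
  width C = f (C 0F) ⊔ f (C 1F) ⊔ f (C 2F)

  sumWidth : Triple n → ℕ
  sumWidth C = f (C 0F) + f (C 1F) + f (C 2F)

  record IsImprovement (W : Subset n) (C : Triple n) : Set where
    field
      isTripartition : IsTripartition C
      -- f (C i) < f W / 2, cleared of the denominator
      half           : ∀ i → 2 * f (C i) < f W
      inside         : ∀ i → f (C i ∩ W) < f W
      outside        : ∀ i → f (C i ∩ ∁ W) < f W

  record IsMinimumImprovement (W : Subset n) (C : Triple n) : Set where
    field
      isImprovement : IsImprovement W C
      minWidth      : ∀ D → IsImprovement W D → width C ≤ width D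
      minArity      : ∀ D → IsImprovement W D → width D ≡ width C →
                      arity C ≤ arity D
      minSumWidth   : ∀ D → IsImprovement W D → width D ≡ width C →
                      arity D ≡ arity C → sumWidth C ≤ sumWidth D

  module _ (T : BranchDecomposition n) where
    open BranchDecomposition T

    -- Reversing the orientation of r replaces T[ u , v ] by its complement,
    -- which has the same improvements.
    IsTImprovement : Edge → Triple n → Set
    IsTImprovement (edge u v _) C = IsMinimumImprovement T[ u , v ] C

    Intersects : Edge → Triple n → Pred Node 0ℓ
    Intersects r C w = 2 ≤ arity (λ i → T⟨ r ⟩[ w ] ∩ C i)

    intersects? : ∀ r C → Decidable (Intersects r C)
    intersects? r C w = 2 ≤? arity (λ i → T⟨ r ⟩[ w ] ∩ C i)

    intersected : Edge → Triple n → Subset order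
    intersected r C = ⟪ intersects? r C ⟫

    record IsGlobalTImprovement (r : Edge) (C : Triple n) : Set where
      field
        isTImprovement : IsTImprovement r C
        minIntersected : ∀ D → IsTImprovement r D →
                         ∣ intersected r C ∣ ≤ ∣ intersected r D ∣

{-# OPTIONS --safe #-}
-- Write A = T_r[w] and K = A ∩ C i, and let R minimise f between K and A.
-- Moving R into C i is uncrossed by submodularity against f R, so it raises
-- neither any f (C j) nor any of the values bounded in an improvement, and it
-- lowers f (C i) by at least f K − f R.  Minimum sum-width gives f K ≤ f R,
-- hence f K ≤ f A.  If f K = f A, then R = A is a possible choice, and the
-- sets T_r[x] being laminar, after moving A the improvement intersects no new
-- node and no longer w.
module Submission where

open import Defs
open import Data.Bool.Base using (if_then_else_; true; false)
open import Data.Nat.Base using (ℕ; suc; _+_; _≤_; _<_; s≤s; z≤n)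
open import Data.Nat.Induction using (<-wellFounded)
open import Data.Nat.Properties
  using (≤-trans; ≤-reflexive; ≤-antisym; ≤-<-trans; <-asym; <⇒≱; ≮⇒≥;
         _<?_; +-mono-≤; +-monoˡ-≤; +-monoʳ-≤; +-cancelʳ-≤; +-cancelˡ-≤;
         *-monoʳ-≤; ⊔-mono-≤; m<m+n; +-comm; suc-injective;
         module ≤-Reasoning)
open import Data.Fin.Base using (Fin)
open import Data.Fin.Patterns using (0F; 1F; 2F)
open import Data.Fin.Properties using (_≟_)
open import Data.Fin.Subset
  using (Subset; _∩_; _∪_; ∁; ⊤; ⁅_⁆; ∣_∣; _∈_; _∉_; _⊆_; Nonempty; Empty)
open import Data.Fin.Subset.Properties
  using (_∈?_; _⊆?_; anySubset?; nonempty?; Empty-unique; ⊆-antisym; ⊆-max; ∈⊤;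
         ⊆-refl; ⊆-trans; p∩q⊆p; p∩q⊆q; x∈p∩q⁺; x∈p∩q⁻; x∈p∪q⁺; x∈p∪q⁻;
         x∈∁p⇒x∉p; x∉p⇒x∈∁p; p⊆q⇒∣p∣≤∣q∣; p⊂q⇒∣p∣<∣q∣;
         ∣⁅x⁆∣≡1; x∈⁅x⁆; x∈⁅y⁆⇒x≡y; ∩-comm; ∩-identityʳ;
         ∩-commutativeMonoid; ∪-∩-booleanAlgebra)
open import Algebra.Bundles using (module CommutativeMonoid)
import Algebra.Properties.CommutativeSemigroup as CommutativeSemigroupProperties
import Algebra.Lattice.Properties.BooleanAlgebra as BooleanAlgebraProperties
import Data.List.Base as L
open import Data.List.Base using ([]; _∷_)
import Data.List.Membership.Propositional as List
import Data.List.Membership.DecPropositional as DecMembership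
open import Data.List.Relation.Unary.All using ([]; _∷_)
open import Data.List.Relation.Unary.All.Properties using (All¬⇒¬Any; ¬Any⇒All¬)
open import Data.List.Relation.Unary.AllPairs using ([]; _∷_)
open import Data.List.Relation.Unary.Any using (here; there)
open import Data.List.Relation.Unary.Unique.Propositional using (Unique)
open import Data.List.Relation.Unary.Unique.Propositional.Properties
  using () renaming (++⁺ to unique-++⁺)
open import Data.Product.Base using (Σ-syntax; ∃; ∃-syntax; _×_; _,_; proj₁; proj₂)
open import Data.Sum.Base using (_⊎_; inj₁; inj₂; [_,_]′)
import Data.Sum.Base as Sum
open import Data.Vec.Properties using (lookup∘tabulate; []=⇒lookup; lookup⇒[]=)
open import Function.Base using (_∘_; id)
open import Function.Bundles using (_⇔_; mk⇔)
open import Induction.WellFounded using (Acc; acc)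
open import Level using (Level)
open import Relation.Binary.Construct.Closure.ReflexiveTransitive
  using (ε; _◅_; _◅◅_)
open import Relation.Binary.PropositionalEquality.Core
  using (_≡_; _≢_; refl; sym; trans; cong; cong₂; subst; subst₂)
open import Relation.Nullary.Decidable.Core
  using (Dec; does; yes; no; _×-dec_)
open import Relation.Nullary.Decidable using (dec-true; dec-false)
open import Relation.Nullary.Negation.Core using (¬_; contradiction)
open import Relation.Unary using (Pred; Decidable)

private
  variable
    ℓ : Level
    k n : ℕ

-- Finite subsets

does⇒∈⟪⟫ : {P : Pred (Fin k) ℓ} (P? : Decidable P) {x : Fin k} →
           does (P? x) ≡ true → x ∈ ⟪ P? ⟫
does⇒∈⟪⟫ P? {x} eq = lookup⇒[]= x _ (trans (lookup∘tabulate (does ∘ P?) x) eq)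

∈⟪⟫⁺ : {P : Pred (Fin k) ℓ} (P? : Decidable P) {x : Fin k} → P x → x ∈ ⟪ P? ⟫
∈⟪⟫⁺ P? {x} px = does⇒∈⟪⟫ P? (dec-true (P? x) px)

∈⟪⟫⇒does : {P : Pred (Fin k) ℓ} (P? : Decidable P) {x : Fin k} →
           x ∈ ⟪ P? ⟫ → does (P? x) ≡ true
∈⟪⟫⇒does P? {x} x∈ = trans (sym (lookup∘tabulate (does ∘ P?) x)) ([]=⇒lookup x∈)

∈⟪⟫⁻ : {P : Pred (Fin k) ℓ} (P? : Decidable P) {x : Fin k} → x ∈ ⟪ P? ⟫ → P x
∈⟪⟫⁻ P? {x} x∈ with P? x | ∈⟪⟫⇒does P? x∈
... | yes px | _ = px

2≤∣p∣ : {p : Subset k} {x y : Fin k} → x ∈ p → y ∈ p → x ≢ y → 2 ≤ ∣ p ∣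
2≤∣p∣ {p = p} {x} {y} x∈p y∈p x≢y =
  subst (_< ∣ p ∣) (∣⁅x⁆∣≡1 x) (p⊂q⇒∣p∣<∣q∣
    ( (λ z∈ → subst (_∈ p) (sym (x∈⁅y⁆⇒x≡y x z∈)) x∈p)
    , y , y∈p , λ y∈ → x≢y (sym (x∈⁅y⁆⇒x≡y x y∈)) ))

∣p∣≤1 : {p : Subset k} (x : Fin k) → (∀ {y} → y ∈ p → y ≡ x) → ∣ p ∣ ≤ 1
∣p∣≤1 {p = p} x only = subst (∣ p ∣ ≤_) (∣⁅x⁆∣≡1 x)
  (p⊆q⇒∣p∣≤∣q∣ λ y∈p → subst (_∈ ⁅ x ⁆) (sym (only y∈p)) (x∈⁅x⁆ x))

p⊆q⇒p∩q≡p : {p q : Subset n} → p ⊆ q → p ∩ q ≡ p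
p⊆q⇒p∩q≡p {p = p} {q} p⊆q =
  ⊆-antisym (p∩q⊆p p q) (λ x∈p → x∈p∩q⁺ (x∈p , p⊆q x∈p))

⊆∁-sym : {p q : Subset n} → p ⊆ ∁ q → q ⊆ ∁ p
⊆∁-sym p⊆∁q x∈q = x∉p⇒x∈∁p (λ x∈p → x∈∁p⇒x∉p (p⊆∁q x∈p) x∈q)

oneSided-⊆ : {p q r : Subset n} → p ⊆ q → q ⊆ r ⊎ q ⊆ ∁ r → p ⊆ r ⊎ p ⊆ ∁ r
oneSided-⊆ p⊆q (inj₁ q⊆r)  = inj₁ (⊆-trans p⊆q q⊆r)
oneSided-⊆ p⊆q (inj₂ q⊆∁r) = inj₂ (⊆-trans p⊆q q⊆∁r)

oneSided-∁ : {p q : Subset n} → p ⊆ q ⊎ p ⊆ ∁ q → p ⊆ ∁ q ⊎ p ⊆ ∁ (∁ q)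
oneSided-∁ (inj₁ p⊆q)  = inj₂ (⊆-trans p⊆q (⊆∁-sym ⊆-refl))
oneSided-∁ (inj₂ p⊆∁q) = inj₁ p⊆∁q

-- Descent on the value of `f`: `anySubset?` decides whether a strictly better set exists, and `_<_`
-- on `ℕ` is well-founded.
∃-minimiser : (f : Subset n → ℕ) {P : Pred (Subset n) ℓ} → Decidable P →
              ∃ P → ∃[ R ] P R × (∀ S → P S → f R ≤ f S)
∃-minimiser f {P} P? (R₀ , pR₀) = descend R₀ pR₀ (<-wellFounded (f R₀))
  where
  descend : ∀ R → P R → Acc _<_ (f R) → ∃[ R ] P R × (∀ S → P S → f R ≤ f S)
  descend R pR (acc rec) with anySubset? (λ S → P? S ×-dec (f S <? f R))
  ... | yes (S , pS , fS<fR) = descend S pS (rec fS<fR)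
  ... | no ∄S = R , pR , λ S pS → ≮⇒≥ λ fS<fR → ∄S (S , pS , fS<fR)

-- Paths in trees

module _ (G : Graph) where
  open Graph G

  vertices-start : ∀ {x y} (p : Walk x y) → x List.∈ vertices p
  vertices-start ε       = here refl
  vertices-start (_ ◅ _) = here refl

  vertices-end : ∀ {x y} (p : Walk x y) → y List.∈ vertices p
  vertices-end ε       = here refl
  vertices-end (_ ◅ p) = there (vertices-end p)

  vertices-◅◅⁻ : ∀ {x y z w} (p : Walk x y) (q : Walk y z) →
                 w List.∈ vertices (p ◅◅ q) →
                 w List.∈ vertices p ⊎ w List.∈ vertices q
  vertices-◅◅⁻ ε       q w∈         = inj₂ w∈
  vertices-◅◅⁻ (_ ◅ p) q (here eq)  = inj₁ (here eq)
  vertices-◅◅⁻ (_ ◅ p) q (there w∈) = Sum.map₁ there (vertices-◅◅⁻ p q w∈)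

  vertices-◅◅⁺ˡ : ∀ {x y z w} (p : Walk x y) (q : Walk y z) →
                  w List.∈ vertices p → w List.∈ vertices (p ◅◅ q)
  vertices-◅◅⁺ˡ ε       q (here refl) = vertices-start q
  vertices-◅◅⁺ˡ (_ ◅ p) q (here eq)   = here eq
  vertices-◅◅⁺ˡ (_ ◅ p) q (there w∈)  = there (vertices-◅◅⁺ˡ p q w∈)

  vertices-◅◅⁺ʳ : ∀ {x y z w} (p : Walk x y) (q : Walk y z) →
                  w List.∈ vertices q → w List.∈ vertices (p ◅◅ q)
  vertices-◅◅⁺ʳ ε       q w∈ = w∈
  vertices-◅◅⁺ʳ (_ ◅ p) q w∈ = there (vertices-◅◅⁺ʳ p q w∈)

  unique-◅◅⁻ˡ : ∀ {x y z} (p : Walk x y) (q : Walk y z) →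
                Unique (vertices (p ◅◅ q)) → Unique (vertices p)
  unique-◅◅⁻ˡ ε       q _          = [] ∷ []
  unique-◅◅⁻ˡ (_ ◅ p) q (x∉ ∷ uniq) =
    ¬Any⇒All¬ _ (All¬⇒¬Any x∉ ∘ vertices-◅◅⁺ˡ p q) ∷ unique-◅◅⁻ˡ p q uniq

  unique-◅◅⁻ʳ : ∀ {x y z} (p : Walk x y) (q : Walk y z) →
                Unique (vertices (p ◅◅ q)) → Unique (vertices q)
  unique-◅◅⁻ʳ ε       q uniq       = uniq
  unique-◅◅⁻ʳ (_ ◅ p) q (_ ∷ uniq) = unique-◅◅⁻ʳ p q uniq

  length-◅◅ : ∀ {x y z} (p : Walk x y) (q : Walk y z) →
              length (p ◅◅ q) ≡ length p + length q
  length-◅◅ ε       q = refl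
  length-◅◅ (_ ◅ p) q = cong suc (length-◅◅ p q)

  length-vertices : ∀ {x y} (p : Walk x y) → L.length (vertices p) ≡ suc (length p)
  length-vertices ε       = refl
  length-vertices (_ ◅ p) = cong suc (length-vertices p)

  0<length : ∀ {x y} (p : Walk x y) → x ≢ y → 0 < length p
  0<length ε       x≢x = contradiction refl x≢x
  0<length (_ ◅ _) _   = s≤s z≤n

  vertices-snoc : ∀ {x y z} (p : Walk x y) (e : y ~ z) →
                  vertices (p ◅◅ e ◅ ε) ≡ vertices p L.++ z ∷ []
  vertices-snoc ε       e = refl
  vertices-snoc (_ ◅ p) e = cong (_ ∷_) (vertices-snoc p e)

  split : ∀ {x y w} (p : Walk x y) → w List.∈ vertices p →
          Σ[ p₁ ∈ Walk x w ] Σ[ p₂ ∈ Walk w y ] p ≡ p₁ ◅◅ p₂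
  split ε       (here refl) = ε , ε , refl
  split (e ◅ p) (here refl) = ε , e ◅ p , refl
  split (e ◅ p) (there w∈) with split p w∈
  ... | p₁ , p₂ , refl = e ◅ p₁ , p₂ , refl

  -- Containment of vertices is all that is recorded, since `eraseLoops` restores uniqueness after
  -- the reversed walk has been appended to another.
  reverse : ∀ {x y} (p : Walk x y) →
            Σ[ q ∈ Walk y x ] (∀ {w} → w List.∈ vertices q → w List.∈ vertices p)
  reverse ε       = ε , id
  reverse (e ◅ p) with reverse p
  ... | q , q⊆p = q ◅◅ ~-sym e ◅ ε , λ w∈ → case (vertices-◅◅⁻ q _ w∈)
    where
    case : ∀ {w} → w List.∈ vertices q ⊎ w List.∈ _ ∷ _ ∷ [] → w List.∈ _ ∷ vertices p
    case (inj₁ w∈q)                  = there (q⊆p w∈q)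
    case (inj₂ (here refl))          = there (vertices-start p)
    case (inj₂ (there (here refl)))  = here refl

  -- If `x` recurs on the loop-free version of the tail, the part of that tail starting at the
  -- recurrence is already a path from `x`.
  eraseLoops : ∀ {x y} (p : Walk x y) →
               Σ[ q ∈ Path x y ] (∀ {w} → w List.∈ vertices (proj₁ q) → w List.∈ vertices p)
  eraseLoops ε = (ε , [] ∷ []) , id
  eraseLoops {x} (e ◅ p) with eraseLoops p
  ... | (q , uniq) , q⊆p with DecMembership._∈?_ _≟_ x (vertices q)
  ...   | no x∉q = (e ◅ q , ¬Any⇒All¬ _ x∉q ∷ uniq) ,
                   λ { (here eq) → here eq ; (there w∈) → there (q⊆p w∈) }
  ...   | yes x∈q with split q x∈q
  ...     | q₁ , q₂ , refl = (q₂ , unique-◅◅⁻ʳ q₁ q₂ uniq) ,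
                             λ w∈ → there (q⊆p (vertices-◅◅⁺ʳ q₁ q₂ w∈))

  module _ (isTree : IsTree G) where
    open IsTree isTree

    -- If the paths leave x along different edges, then a walk between its two
    -- neighbours that avoids x closes a cycle through x.
    vertices-unique : ∀ {x y} (p q : Walk x y) →
                      Unique (vertices p) → Unique (vertices q) →
                      vertices p ≡ vertices q
    vertices-unique ε       ε       _ _ = refl
    vertices-unique ε       (_ ◅ q) _ (x∉q ∷ _) =
      contradiction (vertices-end q) (All¬⇒¬Any x∉q)
    vertices-unique (_ ◅ p) ε       (x∉p ∷ _) _ =
      contradiction (vertices-end p) (All¬⇒¬Any x∉p)
    vertices-unique {x} (_◅_ {j = a} e p) (_◅_ {j = b} e′ q) (x∉p ∷ up) (x∉q ∷ uq)
      with a ≟ b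
    ... | yes refl = cong (x ∷_) (vertices-unique p q up uq)
    ... | no a≢b with reverse q
    ...   | q⁻¹ , q⁻¹⊆q with eraseLoops (p ◅◅ q⁻¹)
    ...     | (c , uc) , c⊆ = contradiction (~-sym e′)
      (acyclic (e ◅ c , ¬Any⇒All¬ _ x∉c ∷ uc) (s≤s (0<length c a≢b)))
      where
      x∉c : ¬ x List.∈ vertices c
      x∉c x∈c = [ All¬⇒¬Any x∉p , All¬⇒¬Any x∉q ∘ q⁻¹⊆q ]′
        (vertices-◅◅⁻ p q⁻¹ (c⊆ x∈c))

    length-unique : ∀ {x y} (p q : Walk x y) →
                    Unique (vertices p) → Unique (vertices q) → length p ≡ length q
    length-unique p q up uq = suc-injective
      (trans (sym (length-vertices p))
        (trans (cong L.length (vertices-unique p q up uq)) (length-vertices q)))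

    -- What remains of `p` from its visit to `w` is a path from `w` to `y`, hence has the same
    -- vertices as `q`.
    vertices-suffix : ∀ {x y w} (p : Walk x y) (q : Walk w y) →
                      Unique (vertices p) → Unique (vertices q) →
                      w List.∈ vertices p →
                      ∀ {z} → z List.∈ vertices q → z List.∈ vertices p
    vertices-suffix ε q up uq (here refl) {z} z∈ =
      subst (z List.∈_) (vertices-unique q ε uq up) z∈
    vertices-suffix (e ◅ p) q up uq (here refl) {z} z∈ =
      subst (z List.∈_) (vertices-unique q (e ◅ p) uq up) z∈
    vertices-suffix (e ◅ p) q (_ ∷ up) uq (there w∈) z∈ =
      there (vertices-suffix p q up uq w∈ z∈)

    -- Whichever of `w` and `z` comes first on `p`, the rest of `p` from there is its path to `y`,
    -- and the other node lies on that rest.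
    vertices-linear : ∀ {x y w z} (p : Walk x y) (q : Walk w y) (s : Walk z y) →
                      Unique (vertices p) → Unique (vertices q) → Unique (vertices s) →
                      w List.∈ vertices p → z List.∈ vertices p →
                      w List.∈ vertices s ⊎ z List.∈ vertices q
    vertices-linear ε q s up uq us (here refl) (here refl) = inj₁ (vertices-start s)
    vertices-linear (e ◅ p) q s up uq us (here refl) z∈ = inj₂
      (subst (_ List.∈_) (vertices-unique (e ◅ p) q up uq) z∈)
    vertices-linear (e ◅ p) q s up uq us (there w∈) (here refl) = inj₁
      (subst (_ List.∈_) (vertices-unique (e ◅ p) s up us) (there w∈))
    vertices-linear (e ◅ p) q s (_ ∷ up) uq us (there w∈) (there z∈) =
      vertices-linear p q s up uq us w∈ z∈

    -- Cutting `p` at `w` leaves a prefix as long as `q`, by uniqueness of paths, and a remainder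
    -- that is nonempty because `w ≢ y`.
    length-prefix : ∀ {x y w} (p : Walk x y) (q : Walk x w) →
                    Unique (vertices p) → Unique (vertices q) →
                    w List.∈ vertices p → w ≢ y → length q < length p
    length-prefix p q up uq w∈ w≢y with split p w∈
    ... | p₁ , p₂ , refl = subst₂ _<_
      (length-unique p₁ q (unique-◅◅⁻ˡ p₁ p₂ up) uq)
      (sym (length-◅◅ p₁ p₂))
      (m<m+n (length p₁) (0<length p₂ w≢y))

    -- Since `z` is new, `p` extended by the edge to `z` is still a path, so uniqueness gives it the
    -- length of `q`.
    length-snoc : ∀ {x y z} (p : Walk x y) (q : Walk x z) →
                  Unique (vertices p) → Unique (vertices q) →
                  y ~ z → ¬ z List.∈ vertices p → length p < length q
    length-snoc {z = z} p q up uq e z∉p = subst (length p <_)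
      (trans (sym (length-◅◅ p (e ◅ ε)))
        (length-unique (p ◅◅ e ◅ ε) q uniq uq))
      (m<m+n (length p) (s≤s z≤n))
      where
      uniq : Unique (vertices (p ◅◅ e ◅ ε))
      uniq = subst Unique (sym (vertices-snoc p e))
        (unique-++⁺ up ([] ∷ []) λ { (z∈p , here refl) → z∉p z∈p })

-- Subtrees of a branch decomposition rooted at an edge

module _ {n} (T : BranchDecomposition n) where
  open BranchDecomposition T

  path-unique : ∀ x y → Unique (vertices (path x y))
  path-unique x y = proj₂ (connected x y)

  module _ (r : Edge) where
    open Edge r

    closer? : ∀ x → Dec (dist x u < dist x v)
    closer? x = dist x u <? dist x v

    -- Names the end that `pathToEdge` selects, so that paths to the edge become paths to a node and
    -- the lemmas on paths with a common end apply.
    end : Node → Node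
    end x = if does (closer? x) then u else v

    pathToEdge-end : ∀ x → pathToEdge r x ≡ vertices (path x (end x))
    pathToEdge-end x with does (closer? x)
    ... | true  = refl
    ... | false = refl

    u≢v : u ≢ v
    u≢v u≡v = ~-irrefl u≡v u~v

    -- Were `v` on the path to `u`, the path to `v` would be a proper prefix of it and so shorter.
    closer⇒∉ : ∀ {x} → dist x u < dist x v → ¬ v List.∈ vertices (path x u)
    closer⇒∉ {x} d v∈ = <-asym d (length-prefix graph isTree _ (path x v)
      (path-unique x u) (path-unique x v) v∈ (u≢v ∘ sym))

    farther⇒∉ : ∀ {x} → ¬ dist x u < dist x v → ¬ u List.∈ vertices (path x v)
    farther⇒∉ {x} d u∈ = d (length-prefix graph isTree _ (path x u)
      (path-unique x v) (path-unique x u) u∈ u≢v)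

    path-suffix : ∀ {x y w} → w List.∈ vertices (path x y) →
                  ∀ {z} → z List.∈ vertices (path w y) → z List.∈ vertices (path x y)
    path-suffix {x} {y} {w} = vertices-suffix graph isTree (path x y) (path w y)
      (path-unique x y) (path-unique w y)

    pathToEdge-if : ∀ x {b} → does (closer? x) ≡ b →
                    pathToEdge r x ≡ (if b then vertices (path x u) else vertices (path x v))
    pathToEdge-if x = cong (λ b → if b then vertices (path x u) else vertices (path x v))

    -- The path from `x` to its nearer end avoids the other end, and so does its suffix starting at
    -- `w`. Prolonging that suffix by `r` gives the longer path from `w` to the other end, so `w`
    -- selects the same end as `x`.
    closer-const : ∀ {w x} → InSubtree r w x → does (closer? w) ≡ does (closer? x)
    closer-const {w} {x} w∈ with closer? x
    ... | yes d = trans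
      (dec-true (closer? w) (length-snoc graph isTree (path w u) (path w v)
        (path-unique w u) (path-unique w v) u~v
        (closer⇒∉ d ∘ path-suffix
          (subst (w List.∈_) (pathToEdge-if x (dec-true (closer? x) d)) w∈))))
      (sym (dec-true (closer? x) d))
    ... | no ¬d = trans
      (dec-false (closer? w) (<-asym (length-snoc graph isTree (path w v) (path w u)
        (path-unique w v) (path-unique w u) (~-sym u~v)
        (farther⇒∉ ¬d ∘ path-suffix
          (subst (w List.∈_) (pathToEdge-if x (dec-false (closer? x) ¬d)) w∈)))))
      (sym (dec-false (closer? x) ¬d))

    end-const : ∀ {w x} → InSubtree r w x → end w ≡ end x
    end-const w∈ = cong (λ b → if b then u else v) (closer-const w∈)

    pathToEdge-suffix : ∀ {w x} → InSubtree r w x →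
                        pathToEdge r w ≡ vertices (path w (end x))
    pathToEdge-suffix {w} w∈ = trans (pathToEdge-end w)
      (cong (vertices ∘ path w) (end-const w∈))

    -- By `end-const`, `x` and `y` aim at the same end, so the path from `x` is a suffix of the path
    -- from `y`.
    inSubtree-trans : ∀ {w x y} → InSubtree r w x → InSubtree r x y → InSubtree r w y
    inSubtree-trans {w} {x} {y} w∈x x∈y = subst (w List.∈_) (sym (pathToEdge-end y))
      (path-suffix (subst (x List.∈_) (pathToEdge-end y) x∈y)
        (subst (w List.∈_) (pathToEdge-suffix x∈y) w∈x))

    -- Both nodes lie on the single path from `y` to `r` and aim at the same end `e`, so one of them
    -- is on the way from the other.
    inSubtree-linear : ∀ {w x y} → InSubtree r w y → InSubtree r x y →
                       InSubtree r w x ⊎ InSubtree r x w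
    inSubtree-linear {w} {x} {y} w∈y x∈y =
      subst₂ (λ xs ys → w List.∈ xs ⊎ x List.∈ ys)
        (sym (pathToEdge-suffix x∈y)) (sym (pathToEdge-suffix w∈y))
        (vertices-linear graph isTree (path y e) (path w e) (path x e)
          (path-unique y e) (path-unique w e) (path-unique x e)
          (subst (w List.∈_) (pathToEdge-end y) w∈y)
          (subst (x List.∈_) (pathToEdge-end y) x∈y))
      where e = end y

    ∈T⁻ : ∀ {w a} → a ∈ T⟨ r ⟩[ w ] → InSubtree r w (leaf a)
    ∈T⁻ {w} = ∈⟪⟫⁻ (inSubtree? r w ∘ leaf)

    T-mono : ∀ {w x} → InSubtree r w x → T⟨ r ⟩[ x ] ⊆ T⟨ r ⟩[ w ]
    T-mono {w} w∈x a∈ = ∈⟪⟫⁺ (inSubtree? r w ∘ leaf) (inSubtree-trans w∈x (∈T⁻ a∈))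

    -- A common leaf has both `w` and `x` on its path to `r`, which makes them comparable.
    T-laminar : ∀ {w x} → Nonempty (T⟨ r ⟩[ w ] ∩ T⟨ r ⟩[ x ]) →
                T⟨ r ⟩[ w ] ⊆ T⟨ r ⟩[ x ] ⊎ T⟨ r ⟩[ x ] ⊆ T⟨ r ⟩[ w ]
    T-laminar (a , a∈) =
      -- The swap reflects that the node nearer to `r` has the larger leaf set.
      Sum.swap (Sum.map T-mono T-mono
        (inSubtree-linear (∈T⁻ (proj₁ (x∈p∩q⁻ _ _ a∈))) (∈T⁻ (proj₂ (x∈p∩q⁻ _ _ a∈)))))

    -- By `closer-const` all leaves of the subtree are on the side of `w`. This is what lets a
    -- subset of `T⟨ r ⟩[ w ]` be moved without spoiling the `inside` and `outside` bounds.
    T-oneSided : ∀ w → T⟨ r ⟩[ w ] ⊆ T[ u , v ] ⊎ T⟨ r ⟩[ w ] ⊆ ∁ T[ u , v ]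
    T-oneSided w with closer? w
    ... | yes d = inj₁ λ {a} a∈ → does⇒∈⟪⟫ (closer? ∘ leaf)
      (trans (sym (closer-const (∈T⁻ a∈))) (dec-true (closer? w) d))
    ... | no ¬d = inj₂ λ {a} a∈ → x∉p⇒x∈∁p λ a∈W → contradiction
      (trans (sym (∈⟪⟫⇒does (closer? ∘ leaf) a∈W))
        (trans (sym (closer-const (∈T⁻ a∈))) (dec-false (closer? w) ¬d)))
      λ ()

-- Uncrossing

arity-mono : {C D : Triple n} → (∀ j → Nonempty (D j) → Nonempty (C j)) → arity D ≤ arity C
arity-mono {C = C} {D} mono = p⊆q⇒∣p∣≤∣q∣ λ {j} j∈ →
  ∈⟪⟫⁺ (nonempty? ∘ C) (mono j (∈⟪⟫⁻ (nonempty? ∘ D) j∈))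

2≤arity : {C : Triple n} {i j : Fin 3} → i ≢ j → Nonempty (C i) → Nonempty (C j) → 2 ≤ arity C
2≤arity {C = C} i≢j Ci Cj =
  2≤∣p∣ (∈⟪⟫⁺ (nonempty? ∘ C) Ci) (∈⟪⟫⁺ (nonempty? ∘ C) Cj) i≢j

arity≤1 : {C : Triple n} (i : Fin 3) → (∀ j → Nonempty (C j) → j ≡ i) → arity C ≤ 1
arity≤1 {C = C} i only = ∣p∣≤1 i λ {j} j∈ → only j (∈⟪⟫⁻ (nonempty? ∘ C) j∈)

module _ {C : Triple n} (t : IsTripartition C) where
  open IsTripartition t

  part : ∀ a → ∃[ j ] a ∈ C j
  part a with x∈p∪q⁻ (C 0F) (C 1F ∪ C 2F) (subst (a ∈_) (sym union) ∈⊤)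
  ... | inj₁ a∈ = 0F , a∈
  ... | inj₂ a∈ with x∈p∪q⁻ (C 1F) (C 2F) a∈
  ...   | inj₁ a∈₁ = 1F , a∈₁
  ...   | inj₂ a∈₂ = 2F , a∈₂

  parts-∉ : ∀ {i j a} → i ≢ j → a ∈ C i → a ∉ C j
  parts-∉ i≢j a∈i a∈j = disjoint _ _ i≢j (_ , x∈p∩q⁺ (a∈i , a∈j))

tripartition : {C : Triple n} → (∀ i j → i ≢ j → Empty (C i ∩ C j)) →
               (∀ a → ∃[ j ] a ∈ C j) → IsTripartition C
tripartition {C = C} disj part′ = record
  { disjoint = disj
  ; union    = ⊆-antisym (⊆-max _) λ {a} _ → case (part′ a)
  }
  where
  case : ∀ {a} → ∃[ j ] a ∈ C j → a ∈ C 0F ∪ C 1F ∪ C 2F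
  case (0F , a∈) = x∈p∪q⁺ (inj₁ a∈)
  case (1F , a∈) = x∈p∪q⁺ (inj₂ (x∈p∪q⁺ (inj₁ a∈)))
  case (2F , a∈) = x∈p∪q⁺ (inj₂ (x∈p∪q⁺ (inj₂ a∈)))

-- Moving a set into one part of a tripartition

absorb : Triple n → Fin 3 → Subset n → Triple n
absorb C i R j with i ≟ j
... | yes _ = C j ∪ R
... | no  _ = C j ∩ ∁ R

-- The conditional `i ≢ j → a ∉ R` treats receiving and losing parts uniformly, so that users need
-- not decide `i ≟ j` again.
∈absorb⁻ : ∀ {C : Triple n} {i R} j {a} → a ∈ absorb C i R j →
           (i ≡ j × a ∈ R) ⊎ (a ∈ C j × (i ≢ j → a ∉ R))
∈absorb⁻ {C = C} {i} {R} j a∈ with i ≟ j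
... | yes i≡j = [ (λ a∈C → inj₂ (a∈C , λ i≢j → contradiction i≡j i≢j))
                , (λ a∈R → inj₁ (i≡j , a∈R)) ]′ (x∈p∪q⁻ (C j) R a∈)
... | no  i≢j with x∈p∩q⁻ (C j) (∁ R) a∈
...   | a∈C , a∈∁R = inj₂ (a∈C , λ _ → x∈∁p⇒x∉p a∈∁R)

∈absorb⁺-C : ∀ {C : Triple n} {i R} j {a} → a ∈ C j → a ∉ R → a ∈ absorb C i R j
∈absorb⁺-C {i = i} j a∈C a∉R with i ≟ j
... | yes _ = x∈p∪q⁺ (inj₁ a∈C)
... | no  _ = x∈p∩q⁺ (a∈C , x∉p⇒x∈∁p a∉R)

∈absorb⁺-R : ∀ {C : Triple n} {R} i {a} → a ∈ R → a ∈ absorb C i R i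
∈absorb⁺-R i a∈R with i ≟ i
... | yes _ = x∈p∪q⁺ (inj₂ a∈R)
... | no i≢i = contradiction refl i≢i

absorb-tripartition : {C : Triple n} (i : Fin 3) (R : Subset n) →
                      IsTripartition C → IsTripartition (absorb C i R)
absorb-tripartition {C = C} i R t = tripartition disj cover
  where
  disj : ∀ j k → j ≢ k → Empty (absorb C i R j ∩ absorb C i R k)
  disj j k j≢k (a , a∈) with x∈p∩q⁻ (absorb C i R j) (absorb C i R k) a∈
  ... | a∈j , a∈k with ∈absorb⁻ {C = C} {i} j a∈j | ∈absorb⁻ {C = C} {i} k a∈k
  ...   | inj₁ (refl , _)   | inj₁ (refl , _)   = j≢k refl
  ...   | inj₁ (refl , a∈R) | inj₂ (_ , a∉R)    = a∉R j≢k a∈R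
  ...   | inj₂ (_ , a∉R)    | inj₁ (refl , a∈R) = a∉R (j≢k ∘ sym) a∈R
  ...   | inj₂ (a∈Cj , _)   | inj₂ (a∈Ck , _)   = parts-∉ t j≢k a∈Cj a∈Ck

  cover : ∀ a → ∃[ j ] a ∈ absorb C i R j
  cover a with a ∈? R
  ... | yes a∈R = i , ∈absorb⁺-R {C = C} i a∈R
  ... | no  a∉R with part t a
  ...   | j , a∈Cj = j , ∈absorb⁺-C {C = C} {i} j a∈Cj a∉R

-- Only part `i` gains elements, so `Y` can newly meet part `i` alone, and the hypothesis excludes
-- this.
absorb-nonempty : ∀ {C : Triple n} {i R Y} →
                  (Nonempty (Y ∩ R) → Nonempty (Y ∩ C i)) →
                  ∀ j → Nonempty (Y ∩ absorb C i R j) → Nonempty (Y ∩ C j)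
absorb-nonempty {C = C} {i} {R} {Y} meets j (a , a∈) with x∈p∩q⁻ Y _ a∈
... | a∈Y , a∈D with ∈absorb⁻ {C = C} {i} j a∈D
...   | inj₁ (refl , a∈R) = meets (a , x∈p∩q⁺ (a∈Y , a∈R))
...   | inj₂ (a∈C , _)    = a , x∈p∩q⁺ (a∈Y , a∈C)

absorb-single : ∀ {C : Triple n} {i R Y} → Y ⊆ R →
                ∀ j → Nonempty (Y ∩ absorb C i R j) → j ≡ i
absorb-single {C = C} {i} {R} {Y} Y⊆R j (a , a∈) with i ≟ j
... | yes i≡j = sym i≡j
... | no  i≢j with x∈p∩q⁻ Y _ a∈
...   | a∈Y , a∈D = contradiction (Y⊆R a∈Y) (x∈∁p⇒x∉p (proj₂ (x∈p∩q⁻ (C j) (∁ R) a∈D)))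

-- The competitors that matter are `K` itself and `R ∩ ∁ X` for sets `X` disjoint from `K`; both lie
-- in this interval.
record IsMinimalBetween (f : Subset n → ℕ) (K A R : Subset n) : Set where
  field
    K⊆R     : K ⊆ R
    R⊆A     : R ⊆ A
    minimal : ∀ S → K ⊆ S → S ⊆ A → f R ≤ f S

∃-minimalBetween : (f : Subset n → ℕ) {K A : Subset n} → K ⊆ A → ∃[ R ] IsMinimalBetween f K A R
∃-minimalBetween f {K} {A} K⊆A
  with ∃-minimiser f (λ R → (K ⊆? R) ×-dec (R ⊆? A)) (K , ⊆-refl , K⊆A)
... | R , (K⊆R , R⊆A) , min = R , record
  { K⊆R = K⊆R ; R⊆A = R⊆A ; minimal = λ S K⊆S S⊆A → min S (K⊆S , S⊆A) }

-- Inequalities from submodularity and symmetry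

module _ {f : Subset n → ℕ} (conn : IsConnectivityFunction f) where
  open IsConnectivityFunction conn

  -- This is submodularity for `X` and `∁ Y`: symmetry replaces `X ∪ ∁ Y` by its complement
  -- `Y ∩ ∁ X`, and `∁ Y` by `Y`.
  posimodular : ∀ X Y → f (X ∩ ∁ Y) + f (Y ∩ ∁ X) ≤ f X + f Y
  posimodular X Y = begin
    f (X ∩ ∁ Y) + f (Y ∩ ∁ X)     ≡⟨ cong (f (X ∩ ∁ Y) +_) f-eq ⟩
    f (X ∩ ∁ Y) + f (X ∪ ∁ Y)     ≡⟨ +-comm (f (X ∩ ∁ Y)) _ ⟩
    f (X ∪ ∁ Y) + f (X ∩ ∁ Y)     ≤⟨ submodular X (∁ Y) ⟩
    f X + f (∁ Y)                 ≡⟨ cong (f X +_) (sym (symmetric Y)) ⟩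
    f X + f Y                     ∎
    where
    open ≤-Reasoning
    open BooleanAlgebraProperties (∪-∩-booleanAlgebra n)
      using (deMorgan₂; ¬-involutive)
    f-eq : f (Y ∩ ∁ X) ≡ f (X ∪ ∁ Y)
    f-eq = trans (cong f (trans (∩-comm Y (∁ X))
                   (trans (cong (∁ X ∩_) (sym (¬-involutive Y)))
                     (sym (deMorgan₂ X (∁ Y))))))
                 (sym (symmetric (X ∪ ∁ Y)))

  module _ {K A R} (R-min : IsMinimalBetween f K A R) where
    open IsMinimalBetween R-min

    fR≤fK : f R ≤ f K
    fR≤fK = minimal K ⊆-refl (⊆-trans K⊆R R⊆A)

    -- Submodularity bounds `f (X ∪ R) + f K` by `f X + f R`, and `K` competes with `R`.
    f-∪R≤ : ∀ X → X ∩ R ≡ K → f (X ∪ R) ≤ f X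
    f-∪R≤ X X∩R≡K = +-cancelʳ-≤ (f K) _ _ (begin
      f (X ∪ R) + f K          ≡⟨ cong (λ S → f (X ∪ R) + f S) (sym X∩R≡K) ⟩
      f (X ∪ R) + f (X ∩ R)    ≤⟨ submodular X R ⟩
      f X + f R                ≤⟨ +-monoʳ-≤ (f X) fR≤fK ⟩
      f X + f K                ∎)
      where open ≤-Reasoning

    -- As `X` misses `K`, the set `R ∩ ∁ X` still lies between `K` and `A`, so `f R` is at most its
    -- value; posimodularity does the rest.
    f-∖R≤ : ∀ X → K ⊆ ∁ X → f (X ∩ ∁ R) ≤ f X
    f-∖R≤ X K⊆∁X = +-cancelʳ-≤ (f R) _ _ (begin
      f (X ∩ ∁ R) + f R              ≤⟨ +-monoʳ-≤ (f (X ∩ ∁ R)) (minimal (R ∩ ∁ X)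
                                          (λ a∈K → x∈p∩q⁺ (K⊆R a∈K , K⊆∁X a∈K))
                                          (R⊆A ∘ p∩q⊆p R (∁ X))) ⟩
      f (X ∩ ∁ R) + f (R ∩ ∁ X)      ≤⟨ posimodular X R ⟩
      f X + f R                      ∎)
      where open ≤-Reasoning

  -- If no summand grows and the total does not drop, no single summand can drop.
  sumWidth-rigid : {C D : Triple n} → (∀ j → f (D j) ≤ f (C j)) →
                   sumWidth f C ≤ sumWidth f D → ∀ i → f (C i) ≤ f (D i)
  sumWidth-rigid {C} {D} D≤C sum≤ 0F =
    +-cancelʳ-≤ (f (C 1F)) _ _ (+-cancelʳ-≤ (f (C 2F)) _ _ (≤-trans sum≤
      (+-mono-≤ (+-monoʳ-≤ (f (D 0F)) (D≤C 1F)) (D≤C 2F))))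
  sumWidth-rigid {C} {D} D≤C sum≤ 1F =
    +-cancelˡ-≤ (f (C 0F)) _ _ (+-cancelʳ-≤ (f (C 2F)) _ _ (≤-trans sum≤
      (+-mono-≤ (+-monoˡ-≤ (f (D 1F)) (D≤C 0F)) (D≤C 2F))))
  sumWidth-rigid {C} {D} D≤C sum≤ 2F =
    +-cancelˡ-≤ (f (C 0F) + f (C 1F)) _ _ (≤-trans sum≤
      (+-monoˡ-≤ (f (D 2F)) (+-mono-≤ (D≤C 0F) (D≤C 1F))))

  -- Exchanges in a minimum improvement

  module _ {W : Subset n} {C : Triple n} (min : IsMinimumImprovement f W C)
           {A : Subset n} (A-side : A ⊆ W ⊎ A ⊆ ∁ W) (i : Fin 3) where
    open IsMinimumImprovement min
    open IsImprovement isImprovement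

    private
      K : Subset n
      K = A ∩ C i

    module _ {R : Subset n} (R-min : IsMinimalBetween f K A R) where
      open IsMinimalBetween R-min

      private
        D : Triple n
        D = absorb C i R

      -- Taking `X` to be `⊤`, `W` or `∁ W` covers every bound of an improvement. If `R` is inside
      -- `X`, moving `R` commutes with intersecting by `X` and the uncrossing inequalities apply to
      -- `C j ∩ X`; if `R` misses `X`, nothing changes within `X`.
      absorb-∩-≤ : ∀ X → R ⊆ X ⊎ R ⊆ ∁ X → ∀ j → f (D j ∩ X) ≤ f (C j ∩ X)
      absorb-∩-≤ X (inj₁ R⊆X) j with i ≟ j
      ... | yes refl = subst (λ S → f S ≤ f (C i ∩ X))
              (⊆-antisym
                (λ a∈ → [ (λ b → let (c , x) = x∈p∩q⁻ (C i) X b in x∈p∩q⁺ (x∈p∪q⁺ (inj₁ c) , x))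
                        , (λ a∈R → x∈p∩q⁺ (x∈p∪q⁺ (inj₂ a∈R) , R⊆X a∈R)) ]′
                        (x∈p∪q⁻ (C i ∩ X) R a∈))
                (λ a∈ → let (cr , x) = x∈p∩q⁻ (C i ∪ R) X a∈ in
                        x∈p∪q⁺ (Sum.map₁ (λ c → x∈p∩q⁺ (c , x)) (x∈p∪q⁻ (C i) R cr))))
              -- Because `K ⊆ R ⊆ A` and `R ⊆ X`, the set `C i ∩ X` meets `R` exactly in `K`.
              (f-∪R≤ R-min (C i ∩ X) (⊆-antisym
                (λ a∈ → let (cx , ar) = x∈p∩q⁻ (C i ∩ X) R a∈ in
                        x∈p∩q⁺ (R⊆A ar , p∩q⊆p (C i) X cx))
                (λ a∈K → x∈p∩q⁺ (x∈p∩q⁺ (p∩q⊆q A (C i) a∈K , R⊆X (K⊆R a∈K)) , K⊆R a∈K))))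
      ... | no i≢j = subst (λ S → f S ≤ f (C j ∩ X))
              (CommutativeSemigroupProperties.xy∙z≈xz∙y
                (CommutativeMonoid.commutativeSemigroup (∩-commutativeMonoid n)) (C j) X (∁ R))
              (f-∖R≤ R-min (C j ∩ X) λ a∈K → x∉p⇒x∈∁p λ a∈ →
                parts-∉ isTripartition i≢j (p∩q⊆q A (C i) a∈K) (p∩q⊆p (C j) X a∈))
      absorb-∩-≤ X (inj₂ R⊆∁X) j = ≤-reflexive (cong f (⊆-antisym
        (λ a∈ → let (d , x) = x∈p∩q⁻ (D j) X a∈ in
          [ (λ (_ , a∈R) → contradiction x (x∈∁p⇒x∉p (R⊆∁X a∈R)))
          , (λ (c , _) → x∈p∩q⁺ (c , x)) ]′ (∈absorb⁻ {C = C} {i} j d))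
        (λ a∈ → let (c , x) = x∈p∩q⁻ (C j) X a∈ in
          x∈p∩q⁺ (∈absorb⁺-C {C = C} {i} j c (λ a∈R → x∈∁p⇒x∉p (R⊆∁X a∈R) x) , x))))

      absorb-≤ : ∀ j → f (D j) ≤ f (C j)
      absorb-≤ j = subst₂ (λ X Y → f X ≤ f Y) (∩-identityʳ (D j)) (∩-identityʳ (C j))
        (absorb-∩-≤ ⊤ (inj₁ (⊆-max R)) j)

      R-side : R ⊆ W ⊎ R ⊆ ∁ W
      R-side = oneSided-⊆ R⊆A A-side

      absorb-isImprovement : IsImprovement f W D
      absorb-isImprovement = record
        { isTripartition = absorb-tripartition i R isTripartition
        ; half    = λ j → ≤-<-trans (*-monoʳ-≤ 2 (absorb-≤ j)) (half j)
        ; inside  = λ j → ≤-<-trans (absorb-∩-≤ W R-side j) (inside j)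
        ; outside = λ j → ≤-<-trans (absorb-∩-≤ (∁ W) (oneSided-∁ R-side) j) (outside j)
        }

      module _ (K≠∅ : Nonempty K) where

        absorb-width : width f D ≡ width f C
        absorb-width = ≤-antisym
          (⊔-mono-≤ (⊔-mono-≤ (absorb-≤ 0F) (absorb-≤ 1F)) (absorb-≤ 2F))
          (minWidth D absorb-isImprovement)

        -- Only part `i` could become nonempty, and `K ⊆ C i` shows that it already was. The reverse
        -- bound needs the tie in width first, as the minimality is lexicographic.
        absorb-arity : arity D ≡ arity C
        absorb-arity = ≤-antisym
          (arity-mono {C = C} {D} λ j (a , a∈) →
            [ (λ { (refl , _) → proj₁ K≠∅ , p∩q⊆q A (C i) (proj₂ K≠∅) })
            , (λ (c , _) → a , c) ]′ (∈absorb⁻ {C = C} {i} j a∈))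
          (minArity D absorb-isImprovement absorb-width)

        absorb-sumWidth : sumWidth f C ≤ sumWidth f D
        absorb-sumWidth = minSumWidth D absorb-isImprovement absorb-width absorb-arity

        -- `D` ties with `C` in width and arity and has no larger sum-width, so it inherits
        -- minimality and may compete in `minIntersected`.
        absorb-isMinimum : IsMinimumImprovement f W D
        absorb-isMinimum = record
          { isImprovement = absorb-isImprovement
          ; minWidth      = λ E e → subst (_≤ width f E) (sym absorb-width) (minWidth E e)
          ; minArity      = λ E e w → subst (_≤ arity E) (sym absorb-arity)
                              (minArity E e (trans w absorb-width))
          ; minSumWidth   = λ E e w a → ≤-trans
                              (+-mono-≤ (+-mono-≤ (absorb-≤ 0F) (absorb-≤ 1F)) (absorb-≤ 2F))
                              (minSumWidth E e (trans w absorb-width) (trans a absorb-arity))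
          }

        -- By rigidity `f (C i ∪ R)` is not below `f (C i)`, so these terms cancel in submodularity
        -- for `C i` and `R`, whose intersection is `K`.
        fK≤fR : f K ≤ f R
        fK≤fR = +-cancelˡ-≤ (f (C i)) _ _ (begin
          f (C i) + f K               ≤⟨ +-monoˡ-≤ (f K) (sumWidth-rigid absorb-≤ absorb-sumWidth i) ⟩
          f (D i) + f K               ≡⟨ cong₂ (λ X Y → f X + f Y) D-i K≡ ⟩
          f (C i ∪ R) + f (C i ∩ R)   ≤⟨ submodular (C i) R ⟩
          f (C i) + f R               ∎)
          where
          open ≤-Reasoning
          D-i : D i ≡ C i ∪ R
          D-i with i ≟ i
          ... | yes _  = refl
          ... | no i≢i = contradiction refl i≢i
          K≡ : K ≡ C i ∩ R
          K≡ = ⊆-antisym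
            (λ a∈K → x∈p∩q⁺ (p∩q⊆q A (C i) a∈K , K⊆R a∈K))
            (λ a∈ → let (c , ar) = x∈p∩q⁻ (C i) R a∈ in x∈p∩q⁺ (R⊆A ar , c))

    -- Allowing every `S` in the interval, not only `A`, is what later shows that `A` is itself a
    -- minimiser in the equality case.
    f-part-≤ : ∀ S → K ⊆ S → S ⊆ A → f K ≤ f S
    f-part-≤ S K⊆S S⊆A with nonempty? K
    -- An empty `K` is handled by `f ⊥ ≡ 0`: `C i` might then be empty too, and absorbing could
    -- raise the arity.
    ... | no K=∅ = subst (_≤ f S) (sym (trans (cong f (Empty-unique K=∅)) f-⊥)) z≤n
    ... | yes K≠∅ with ∃-minimalBetween f (p∩q⊆p A (C i))
    ...   | R , R-min = ≤-trans (fK≤fR R-min K≠∅)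
                          (IsMinimalBetween.minimal R-min S K⊆S S⊆A)

  -- The equality case for global improvements

  module _ (T : BranchDecomposition n) {r : BranchDecomposition.Edge T} {C : Triple n}
           (global : IsGlobalTImprovement f T r C)
           (i : Fin 3) (w : BranchDecomposition.Node T) where
    open BranchDecomposition T
    open IsGlobalTImprovement global
    open IsMinimumImprovement isTImprovement using (isImprovement)
    open IsImprovement isImprovement using (isTripartition)

    private
      A : Subset n
      A = T⟨ r ⟩[ w ]

    -- A point `a` of `A` outside `C i` lies in another part, so `C` intersects `w`. Absorbing all
    -- of `A` then makes the set of intersected nodes strictly smaller, against `minIntersected`.
    f-part-tight⇒⊆ : Nonempty (A ∩ C i) → f (A ∩ C i) ≡ f A → A ⊆ C i
    f-part-tight⇒⊆ (b , b∈K) tight {a} a∈A with a ∈? C i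
    ... | yes a∈Ci = a∈Ci
    ... | no  a∉Ci with part isTripartition a
    ...   | j , a∈Cj = contradiction
      (minIntersected D (absorb-isMinimum isTImprovement (T-oneSided T r w) i A-min (b , b∈K)))
      (<⇒≱ (p⊂q⇒∣p∣<∣q∣ (shrinks , w , w∈C , w∉D)))
      where
      D : Triple n
      D = absorb C i A

      A-min : IsMinimalBetween f (A ∩ C i) A A
      A-min = record
        { K⊆R     = p∩q⊆p A (C i)
        ; R⊆A     = ⊆-refl
        -- Tightness turns the lower bound `f (A ∩ C i)` on the interval into the lower bound `f A`.
        ; minimal = λ S K⊆S S⊆A → subst (_≤ f S) tight
                      (f-part-≤ isTImprovement (T-oneSided T r w) i S K⊆S S⊆A)
        }

      ¬intersects-inside : ∀ x → T⟨ r ⟩[ x ] ⊆ A → ¬ Intersects f T r D x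
      ¬intersects-inside x X⊆A 2≤ = contradiction
        (arity≤1 i (absorb-single {C = C} X⊆A)) (<⇒≱ 2≤)

      shrinks : intersected f T r D ⊆ intersected f T r C
      shrinks {x} x∈ = ∈⟪⟫⁺ (intersects? f T r C) (≤-trans 2≤ (arity-mono
        (absorb-nonempty {C = C} meets)))
        where
        X : Subset n
        X = T⟨ r ⟩[ x ]
        2≤ : Intersects f T r D x
        2≤ = ∈⟪⟫⁻ (intersects? f T r D) x∈
        -- By laminarity either `X ⊆ A`, and then `D` meets `X` in part `i` only, or `X` contains
        -- `A` and with it the point `b` of `C i`.
        meets : Nonempty (X ∩ A) → Nonempty (X ∩ C i)
        meets X∩A with T-laminar T r {x} {w} X∩A
        ... | inj₁ X⊆A = contradiction 2≤ (¬intersects-inside x X⊆A)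
        ... | inj₂ A⊆X = b , x∈p∩q⁺ (A⊆X (p∩q⊆p A (C i) b∈K) , p∩q⊆q A (C i) b∈K)

      w∈C : w ∈ intersected f T r C
      w∈C = ∈⟪⟫⁺ (intersects? f T r C) (2≤arity {C = λ k → A ∩ C k} {i} {j}
        (λ { refl → a∉Ci a∈Cj }) (b , b∈K) (a , x∈p∩q⁺ (a∈A , a∈Cj)))

      w∉D : w ∉ intersected f T r D
      w∉D w∈ = ¬intersects-inside w ⊆-refl (∈⟪⟫⁻ (intersects? f T r D) w∈)

theorem6 : ∀ {n : ℕ} (f : Subset n → ℕ) → IsConnectivityFunction f →
    (T : BranchDecomposition n) → let open BranchDecomposition T in
    (r : Edge) (C : Triple n) → IsGlobalTImprovement f T r C →
    (i : Fin 3) (w : Node) →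
    (f (T⟨ r ⟩[ w ] ∩ C i) ≤ f T⟨ r ⟩[ w ]) ×
    (Nonempty (T⟨ r ⟩[ w ] ∩ C i) →
    ((f (T⟨ r ⟩[ w ] ∩ C i) ≡ f T⟨ r ⟩[ w ]) ⇔ (T⟨ r ⟩[ w ] ⊆ C i)))
theorem6 f conn T r C global i w =
  f-part-≤ conn (IsGlobalTImprovement.isTImprovement global) (T-oneSided T r w) i
    T⟨ r ⟩[ w ] (p∩q⊆p _ (C i)) ⊆-refl ,
  λ K≠∅ → mk⇔ (f-part-tight⇒⊆ conn T global i w K≠∅) (cong f ∘ p⊆q⇒p∩q≡p)
  where open BranchDecomposition T
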